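{- Let $V$ be a finite set, let $A$ be a $V\times V$-matrix over an arbitrary field, and let $X\subseteq V$ be such that the principal submatrix $A[X]$ is nonsingular. Then, for every $Y\subseteq V$, $n((A*X)[Y]) = n(A[X\oplus Y])$.
   Context: Matrices are indexed (rows and columns) by a finite set $V$. For $X\subseteq V$, $A[X]$ denotes the principal submatrix of $A$ with rows and columns indexed by $X$. $n(\cdot)$ denotes nullity (dimension of the null space). The empty matrix is nonsingular by convention (nullity $0$, determinant $1$). $\oplus$ denotes symmetric difference of sets. Principal pivot transform: if $A[X]$ is nonsingular, then, writing (after ordering $V$ so that the elements of $X$ come first) $A=\begin{pmatrix} P & Q \\ R & S \end{pmatrix}$ with $P=A[X]$, the pivot of $A$ on $X$ is the $V\times V$-matrix $$A*X=\begin{pmatrix} P^{ -1} & -P^{ -1} Q \\ R P^{ -1} & S - R P^{ -1} Q \end{pmatrix},$$ with rows and columns indexed by $V$ in the same way. -}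

module Defs where

open import Algebra.Apartness.Bundles using (HeytingField; HeytingCommutativeRing)
open import Algebra.Bundles using (CommutativeRing)
open import Algebra.Definitions using (Invertible)
import Algebra.Properties.Semiring.Sum as SemiringSum
open import Data.Bool.Base using (if_then_else_)
open import Data.Fin.Base using (Fin)
open import Data.Fin.Properties using (_≟_)
open import Data.Fin.Subset using (Subset; _∈_; ∁; _∪_; _─_)
open import Data.Fin.Subset.Properties using (_∈?_; x∉p⇒x∈∁p)
open import Data.Nat.Base using (ℕ)
open import Data.Product.Base using (∃; _,_; proj₁)
open import Data.Sum.Base as Sum using (_⊎_; [_,_]′)
open import Function.Base using (const)
open import Level using (_⊔_)
open import Relation.Nullary.Decidable using (does; toSum)

infixl 6 _⊕_

_⊕_ : ∀ {n} → Subset n → Subset n → Subset n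
X ⊕ Y = (X ─ Y) ∪ (Y ─ X)

El : ∀ {n} → Subset n → Set
El {n} X = ∃ λ (v : Fin n) → v ∈ X

split : ∀ {n} (X : Subset n) → Fin n → El X ⊎ El (∁ X)
split X v = Sum.map (v ,_) (λ v∉X → v , x∉p⇒x∈∁p v∉X) (toSum (v ∈? X))

-- With excluded middle, every field is a HeytingField, taking _#_ to be the
-- negation of _≈_.
module Over {c ℓ₁ ℓ₂} (F : HeytingField c ℓ₁ ℓ₂) where

  open CommutativeRing
    (HeytingCommutativeRing.commutativeRing (HeytingField.heytingCommutativeRing F))
    using (Carrier; _≈_; _+_; _*_; -_; _-_; 0#; 1#; semiring)
  open SemiringSum semiring using (sum)

  infix  4 _≈ⱽ_ _≈ᴹ_
  infixl 7 _*ⱽ_ _*ᴹ_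
  infixl 6 _-ᴹ_
  infix  8 -ᴹ_
  infixl 9 _[_∣_] _[_]

  -- The finite set V is Fin n.  The index type I below is Fin n (for
  -- V × V-matrices) or El X (for submatrices).
  Vect : Set → Set c
  Vect I = I → Carrier

  Matrix : Set → Set → Set c
  Matrix I J = I → J → Carrier

  _≈ⱽ_ : ∀ {I} → Vect I → Vect I → Set ℓ₁
  v ≈ⱽ w = ∀ i → v i ≈ w i

  _≈ᴹ_ : ∀ {I J} → Matrix I J → Matrix I J → Set ℓ₁
  M ≈ᴹ N = ∀ i j → M i j ≈ N i j

  0ⱽ : ∀ {I} → Vect I
  0ⱽ _ = 0#

  -- The sum over X, computed over all of V by extending f by zero.
  ∑ : ∀ {n} (X : Subset n) → (El X → Carrier) → Carrier
  ∑ X f = sum λ v → [ f , const 0# ]′ (split X v)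

  _*ⱽ_ : ∀ {n I} {X : Subset n} → Matrix I (El X) → Vect (El X) → Vect I
  _*ⱽ_ {X = X} M v i = ∑ X λ j → M i j * v j

  _*ᴹ_ : ∀ {n I J} {X : Subset n} → Matrix I (El X) → Matrix (El X) J → Matrix I J
  _*ᴹ_ {X = X} M N i k = ∑ X λ j → M i j * N j k

  -ᴹ_ : ∀ {I J} → Matrix I J → Matrix I J
  (-ᴹ M) i j = - M i j

  _-ᴹ_ : ∀ {I J} → Matrix I J → Matrix I J → Matrix I J
  (M -ᴹ N) i j = M i j - N i j

  1ᴹ : ∀ {n} {X : Subset n} → Matrix (El X) (El X)
  1ᴹ i j = if does (proj₁ i ≟ proj₁ j) then 1# else 0#

  Nonsingular : ∀ {n} {X : Subset n} → Matrix (El X) (El X) → Set (c ⊔ ℓ₁)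
  Nonsingular = Invertible _≈ᴹ_ 1ᴹ _*ᴹ_

  _[_∣_] : ∀ {n} → Matrix (Fin n) (Fin n) → (X Y : Subset n) → Matrix (El X) (El Y)
  (A [ X ∣ Y ]) i j = A (proj₁ i) (proj₁ j)

  _[_] : ∀ {n} → Matrix (Fin n) (Fin n) → (X : Subset n) → Matrix (El X) (El X)
  A [ X ] = A [ X ∣ X ]

  blocks : ∀ {n} (X : Subset n) →
           Matrix (El X)     (El X) → Matrix (El X)     (El (∁ X)) →
           Matrix (El (∁ X)) (El X) → Matrix (El (∁ X)) (El (∁ X)) →
           Matrix (Fin n) (Fin n)
  blocks X P Q R S u v =
    [ (λ i → [ P i , Q i ]′ (split X v))
    , (λ i → [ R i , S i ]′ (split X v))
    ]′ (split X u)

  pivot : ∀ {n} (A : Matrix (Fin n) (Fin n)) (X : Subset n) →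
          Nonsingular (A [ X ]) → Matrix (Fin n) (Fin n)
  pivot A X (P⁻¹ , _) =
    blocks X P⁻¹         (-ᴹ (P⁻¹ *ᴹ Q))
             (R *ᴹ P⁻¹)  (S -ᴹ R *ᴹ P⁻¹ *ᴹ Q)
    where
    Q = A [ X ∣ ∁ X ]
    R = A [ ∁ X ∣ X ]
    S = A [ ∁ X ∣ ∁ X ]

  combination : ∀ {I k} → (Fin k → Carrier) → (Fin k → Vect I) → Vect I
  combination a b i = sum λ j → a j * b j i

  record HasDimension {I ℓ} (U : Vect I → Set ℓ) (k : ℕ) : Set (c ⊔ ℓ₁ ⊔ ℓ) where
    field
      basis       : Fin k → Vect I
      basis∈      : ∀ j → U (basis j)
      independent : ∀ a → combination a basis ≈ⱽ 0ⱽ → ∀ j → a j ≈ 0#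
      spanning    : ∀ v → U v → ∃ λ a → v ≈ⱽ combination a basis

  NullSpace : ∀ {n} {X : Subset n} → Matrix (El X) (El X) → Vect (El X) → Set ℓ₁
  NullSpace M v = M *ⱽ v ≈ⱽ 0ⱽ

  -- The graph of n(·).  It is a relation because computing a dimension needs
  -- decidable equality in F; the k is unique by invariance of dimension.
  HasNullity : ∀ {n} {X : Subset n} → Matrix (El X) (El X) → ℕ → Set (c ⊔ ℓ₁)
  HasNullity M = HasDimension (NullSpace M)

{-# OPTIONS --safe #-}

-- For every vector x the pivot A * X maps the vector obtained from x by
-- replacing its coordinates in X by those of A x to the one obtained from A x
-- by replacing its coordinates in X by those of x, and A does the same with
-- respect to A * X.  If x is supported on X ⊕ Y and A x vanishes on X ⊕ Y,
-- then the first of these vectors is supported on Y and the second vanishes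
-- on Y.  So exchanging coordinates in X gives mutually inverse linear maps
-- between the null spaces of A[X ⊕ Y] and (A * X)[Y].
module Submission where

open import Defs
open import Algebra.Apartness.Bundles using (HeytingField; HeytingCommutativeRing)
open import Algebra.Bundles using (CommutativeRing)
import Algebra.Properties.Ring as RingProperties
import Algebra.Properties.Semiring.Sum as SemiringSum
open import Data.Bool.Base using (true; false; if_then_else_)
open import Data.Fin.Base using (Fin; punchIn)
open import Data.Fin.Properties using (_≟_; punchInᵢ≢i)
open import Data.Fin.Subset using (Subset; _∈_; _∉_; ∁; _─_)
open import Data.Fin.Subset.Properties
  using (_∈?_; x∉p⇒x∈∁p; x∈∁p⇒x∉p; x∈p⇒x∉∁p; x∈p∧x∉q⇒x∈p─q; x∈p∪q⁺; x∈p∪q⁻; p─q⊆p)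
open import Data.Nat.Base using (ℕ; suc)
open import Data.Product.Base using (_,_; proj₁; proj₂)
open import Data.Sum.Base using (inj₁; inj₂; [_,_]′)
open import Data.Vec.Base using ([]; _∷_; here; there)
open import Data.Vec.Properties.WithK using ([]=-irrelevant)
open import Function.Base using (const; _∘_)
open import Function.Bundles using (_⇔_; mk⇔)
open import Relation.Binary.PropositionalEquality.Core as ≡ using (_≡_; _≢_)
import Relation.Binary.Reasoning.Setoid as SetoidReasoning
open import Relation.Nullary.Decidable using (yes; no; dec-true; dec-false)
open import Relation.Nullary.Negation using (contradiction)

-- Membership in the symmetric difference.

x∈q⇒x∉p─q : ∀ {n} (p q : Subset n) {x} → x ∈ q → x ∉ p ─ q
x∈q⇒x∉p─q (_ ∷ p) (true  ∷ q) here        ()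
x∈q⇒x∉p─q (_ ∷ p) (true  ∷ q) (there x∈q) (there x∈p─q) = x∈q⇒x∉p─q p q x∈q x∈p─q
x∈q⇒x∉p─q (_ ∷ p) (false ∷ q) (there x∈q) (there x∈p─q) = x∈q⇒x∉p─q p q x∈q x∈p─q

x∈p∧x∉q⇒x∈p⊕q : ∀ {n} {p q : Subset n} {x} → x ∈ p → x ∉ q → x ∈ p ⊕ q
x∈p∧x∉q⇒x∈p⊕q x∈p x∉q = x∈p∪q⁺ (inj₁ (x∈p∧x∉q⇒x∈p─q x∈p x∉q))

x∉p∧x∈q⇒x∈p⊕q : ∀ {n} {p q : Subset n} {x} → x ∉ p → x ∈ q → x ∈ p ⊕ q
x∉p∧x∈q⇒x∈p⊕q x∉p x∈q = x∈p∪q⁺ (inj₂ (x∈p∧x∉q⇒x∈p─q x∈q x∉p))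

x∈p∧x∈q⇒x∉p⊕q : ∀ {n} {p q : Subset n} {x} → x ∈ p → x ∈ q → x ∉ p ⊕ q
x∈p∧x∈q⇒x∉p⊕q {p = p} {q} x∈p x∈q =
  [ x∈q⇒x∉p─q p q x∈q , x∈q⇒x∉p─q q p x∈p ]′ ∘ x∈p∪q⁻ (p ─ q) (q ─ p)

x∉p∧x∉q⇒x∉p⊕q : ∀ {n} {p q : Subset n} {x} → x ∉ p → x ∉ q → x ∉ p ⊕ q
x∉p∧x∉q⇒x∉p⊕q {p = p} {q} x∉p x∉q =
  [ x∉p ∘ p─q⊆p p q , x∉q ∘ p─q⊆p q p ]′ ∘ x∈p∪q⁻ (p ─ q) (q ─ p)

-- This is what makes the roles of `Y` and `X ⊕ Y` interchangeable in the final argument.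
p⊕[p⊕q]≡q : ∀ {n} (p q : Subset n) → p ⊕ (p ⊕ q) ≡ q
p⊕[p⊕q]≡q []          []          = ≡.refl
p⊕[p⊕q]≡q (true  ∷ p) (true  ∷ q) = ≡.cong (true  ∷_) (p⊕[p⊕q]≡q p q)
p⊕[p⊕q]≡q (true  ∷ p) (false ∷ q) = ≡.cong (false ∷_) (p⊕[p⊕q]≡q p q)
p⊕[p⊕q]≡q (false ∷ p) (true  ∷ q) = ≡.cong (true  ∷_) (p⊕[p⊕q]≡q p q)
p⊕[p⊕q]≡q (false ∷ p) (false ∷ q) = ≡.cong (false ∷_) (p⊕[p⊕q]≡q p q)

-- Splitting indices between `X` and its complement.

split-∈ : ∀ {n} (X : Subset n) (i : El X) → split X (proj₁ i) ≡ inj₁ i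
split-∈ X (v , v∈X) with v ∈? X
-- The decision brings its own proof of membership; such proofs are unique, so the index found is
-- the given one.
... | yes v∈X′ = ≡.cong (inj₁ ∘ (v ,_)) ([]=-irrelevant v∈X′ v∈X)
... | no  v∉X  = contradiction v∈X v∉X

split-∉ : ∀ {n} (X : Subset n) (i : El (∁ X)) → split X (proj₁ i) ≡ inj₂ i
split-∉ X (v , v∈∁X) with v ∈? X
... | yes v∈X = contradiction v∈∁X (x∈p⇒x∉∁p v∈X)
... | no  v∉X = ≡.cong (inj₂ ∘ (v ,_)) ([]=-irrelevant (x∉p⇒x∈∁p v∉X) v∈∁X)

-- Each case receives an element of `El X` or `El (∁ X)`, the form in which the lemmas about blocks
-- and extensions take their index.
split-elim : ∀ {n p} (X : Subset n) (P : Fin n → Set p) →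
             (∀ (i : El X) → P (proj₁ i)) → (∀ (i : El (∁ X)) → P (proj₁ i)) →
             ∀ v → P v
split-elim X P on off v with v ∈? X
... | yes v∈X = on  (v , v∈X)
... | no  v∉X = off (v , x∉p⇒x∈∁p v∉X)

module _ {c ℓ₁ ℓ₂} (F : HeytingField c ℓ₁ ℓ₂) where

  open Over F
  open CommutativeRing
    (HeytingCommutativeRing.commutativeRing (HeytingField.heytingCommutativeRing F))
  open RingProperties ring
    using (x[y-z]≈xy-xz; [y-z]x≈yx-zx; -‿distribˡ-*; +-inverseˡ-unique;
           //-rightDividesˡ; //-rightDividesʳ)
  open SemiringSum semiring
    using (sum; sum-cong-≋; sum-replicate-zero; sum-remove; ∑-distrib-+; ∑-comm;
           *-distribˡ-sum)
  open SetoidReasoning setoid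

  infixr 7 _·_

  -- Finite sums and linear combinations.

  sum-zero : ∀ {n} (f : Fin n → Carrier) → (∀ v → f v ≈ 0#) → sum f ≈ 0#
  sum-zero {n} f f≈0 = trans (sum-cong-≋ f≈0) (sum-replicate-zero n)

  sum-single : ∀ {n} (f : Fin n → Carrier) u → (∀ v → v ≢ u → f v ≈ 0#) → sum f ≈ f u
  sum-single {suc n} f u f≈0 = begin
    sum f                        ≈⟨ sum-remove f ⟩
    f u + sum (f ∘ punchIn u)    ≈⟨ +-congˡ (sum-zero _ λ v → f≈0 _ (punchInᵢ≢i u v)) ⟩
    f u + 0#                     ≈⟨ +-identityʳ _ ⟩
    f u                          ∎

  combination-cong : ∀ {I k} (a : Fin k → Carrier) {b b′ : Fin k → Vect I} →
                     (∀ j → b j ≈ⱽ b′ j) → combination a b ≈ⱽ combination a b′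
  combination-cong a b≈b′ i = sum-cong-≋ λ j → *-congˡ (b≈b′ j i)

  -- Extension by zero and sums over a subset.

  extend : ∀ {n} (X : Subset n) → Vect (El X) → Vect (Fin n)
  extend X f v = [ f , const 0# ]′ (split X v)

  extend-∈ : ∀ {n} (X : Subset n) f (i : El X) → extend X f (proj₁ i) ≈ f i
  extend-∈ X f i rewrite split-∈ X i = refl

  extend-∉ : ∀ {n} (X : Subset n) f {v} → v ∉ X → extend X f v ≈ 0#
  extend-∉ X f {v} v∉X rewrite split-∉ X (v , x∉p⇒x∈∁p v∉X) = refl

  extend-cong : ∀ {n} (X : Subset n) {f g} → f ≈ⱽ g → extend X f ≈ⱽ extend X g
  extend-cong X f≈g v with split X v
  ... | inj₁ i = f≈g i
  ... | inj₂ _ = refl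

  extend-restrict : ∀ {n} (X : Subset n) f → (∀ {v} → v ∉ X → f v ≈ 0#) →
                    extend X (f ∘ proj₁) ≈ⱽ f
  extend-restrict X f f≈0 = split-elim X _ (extend-∈ X _)
    λ i → trans (extend-∉ X _ (x∈∁p⇒x∉p (proj₂ i))) (sym (f≈0 (x∈∁p⇒x∉p (proj₂ i))))

  extend-combination : ∀ {n k} (X : Subset n) (a : Fin k → Carrier) b →
    extend X (combination a b) ≈ⱽ combination a (extend X ∘ b)
  extend-combination X a b v with split X v
  ... | inj₁ i = refl
  ... | inj₂ _ = sym (sum-zero _ λ j → zeroʳ (a j))

  -- `∑ X f` is by definition `sum (extend X f)`, so most laws of `∑` reduce to laws of `sum` and a
  -- pointwise identity of extensions.
  ∑-cong : ∀ {n} {X : Subset n} {f g : Vect (El X)} → f ≈ⱽ g → ∑ X f ≈ ∑ X g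
  ∑-cong {X = X} f≈g = sum-cong-≋ (extend-cong X f≈g)

  ∑-+ : ∀ {n} {X : Subset n} (f g : Vect (El X)) → ∑ X (λ i → f i + g i) ≈ ∑ X f + ∑ X g
  ∑-+ {X = X} f g = trans (sum-cong-≋ extend-+) (∑-distrib-+ (extend X f) (extend X g))
    where
    extend-+ : extend X (λ i → f i + g i) ≈ⱽ λ v → extend X f v + extend X g v
    extend-+ v with split X v
    ... | inj₁ i = refl
    ... | inj₂ _ = sym (+-identityˡ 0#)

  ∑-zero : ∀ {n} {X : Subset n} (f : Vect (El X)) → f ≈ⱽ 0ⱽ → ∑ X f ≈ 0#
  ∑-zero {X = X} f f≈0 = sum-zero _ extend-0
    where
    extend-0 : extend X f ≈ⱽ 0ⱽ
    extend-0 v with split X v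
    ... | inj₁ i = f≈0 i
    ... | inj₂ _ = refl

  ∑-neg : ∀ {n} {X : Subset n} (f : Vect (El X)) → ∑ X (λ i → - f i) ≈ - ∑ X f
  ∑-neg f = +-inverseˡ-unique _ _
    (trans (sym (∑-+ _ f)) (∑-zero _ λ i → -‿inverseˡ (f i)))

  ∑-minus : ∀ {n} {X : Subset n} (f g : Vect (El X)) → ∑ X (λ i → f i - g i) ≈ ∑ X f - ∑ X g
  ∑-minus f g = trans (∑-+ f _) (+-congˡ (∑-neg g))

  *-distribˡ-∑ : ∀ {n} {X : Subset n} x (f : Vect (El X)) → x * ∑ X f ≈ ∑ X (λ i → x * f i)
  *-distribˡ-∑ {X = X} x f = trans (*-distribˡ-sum x (extend X f)) (sum-cong-≋ *-extend)
    where
    *-extend : ∀ v → x * extend X f v ≈ extend X (λ i → x * f i) v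
    *-extend v with split X v
    ... | inj₁ i = refl
    ... | inj₂ _ = zeroʳ x

  *-distribʳ-∑ : ∀ {n} {X : Subset n} x (f : Vect (El X)) → ∑ X f * x ≈ ∑ X (λ i → f i * x)
  *-distribʳ-∑ x f =
    trans (*-comm _ x) (trans (*-distribˡ-∑ x f) (∑-cong λ i → *-comm x (f i)))

  -- Extension by zero commutes with `sum` and with extension in the other variable. Both sides thus
  -- become double sums over all of `Fin m` and `Fin n`, where `∑-comm` applies.
  ∑-swap : ∀ {m n} {X : Subset m} {Y : Subset n} (f : El X → El Y → Carrier) →
           ∑ X (λ i → ∑ Y (f i)) ≈ ∑ Y (λ j → ∑ X (λ i → f i j))
  ∑-swap {m} {n} {X} {Y} f = begin
    sum (extend X λ i → sum (extend Y (f i)))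
      ≈⟨ sum-cong-≋ (extend-sum X λ i → extend Y (f i)) ⟩
    sum (λ u → sum λ v → extend X (λ i → extend Y (f i) v) u)
      ≈⟨ ∑-comm (λ u v → extend X (λ i → extend Y (f i) v) u) ⟩
    sum (λ v → sum λ u → extend X (λ i → extend Y (f i) v) u)
      ≈⟨ sum-cong-≋ (λ v → sum-cong-≋ λ u → extend-swap u v) ⟩
    sum (λ v → sum λ u → extend Y (λ j → extend X (λ i → f i j) u) v)
      ≈⟨ sum-cong-≋ (extend-sum Y λ j → extend X (λ i → f i j)) ⟨
    sum (extend Y λ j → sum (extend X λ i → f i j)) ∎
    where
    extend-sum : ∀ {k l} (Z : Subset k) (g : El Z → Fin l → Carrier) →
                 extend Z (λ i → sum (g i)) ≈ⱽ λ u → sum λ v → extend Z (λ i → g i v) u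
    extend-sum {l = l} Z g u with split Z u
    ... | inj₁ i = refl
    ... | inj₂ _ = sym (sum-replicate-zero l)

    extend-swap : ∀ u v → extend X (λ i → extend Y (f i) v) u ≈
                          extend Y (λ j → extend X (λ i → f i j) u) v
    extend-swap u v with split X u | split Y v
    ... | inj₁ i | inj₁ j = refl
    ... | inj₁ i | inj₂ _ = refl
    ... | inj₂ _ | inj₁ j = refl
    ... | inj₂ _ | inj₂ _ = refl

  -- At every index exactly one of the two extensions by zero equals `f` and the other is zero.
  sum-partition : ∀ {n} (X : Subset n) (f : Vect (Fin n)) →
                  sum f ≈ ∑ X (f ∘ proj₁) + ∑ (∁ X) (f ∘ proj₁)
  sum-partition X f = trans
    (sum-cong-≋ (split-elim X _
      (λ { i@(_ , v∈X) → sym (trans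
        (+-cong (extend-∈ X _ i) (extend-∉ (∁ X) _ (x∈p⇒x∉∁p v∈X))) (+-identityʳ _)) })
      (λ { i@(_ , v∈∁X) → sym (trans
        (+-cong (extend-∉ X _ (x∈∁p⇒x∉p v∈∁X)) (extend-∈ (∁ X) _ i)) (+-identityˡ _)) })))
    (∑-distrib-+ (extend X (f ∘ proj₁)) (extend (∁ X) (f ∘ proj₁)))

  -- Products of submatrices with vectors.

  module _ {n} {I : Set} {X : Subset n} where

    *ⱽ-congˡ : (M : Matrix I (El X)) {v w : Vect (El X)} → v ≈ⱽ w → M *ⱽ v ≈ⱽ M *ⱽ w
    *ⱽ-congˡ M v≈w i = ∑-cong λ j → *-congˡ (v≈w j)

    *ⱽ-congʳ : {M N : Matrix I (El X)} (v : Vect (El X)) → M ≈ᴹ N → M *ⱽ v ≈ⱽ N *ⱽ v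
    *ⱽ-congʳ v M≈N i = ∑-cong λ j → *-congʳ (M≈N i j)

    *ⱽ-distribˡ-minus : (M : Matrix I (El X)) (v w : Vect (El X)) →
      M *ⱽ (λ j → v j - w j) ≈ⱽ λ i → (M *ⱽ v) i - (M *ⱽ w) i
    *ⱽ-distribˡ-minus M v w i =
      trans (∑-cong λ j → x[y-z]≈xy-xz (M i j) (v j) (w j))
            (∑-minus (λ j → M i j * v j) (λ j → M i j * w j))

    *ⱽ-distribʳ-minus : (M N : Matrix I (El X)) (v : Vect (El X)) →
      (M -ᴹ N) *ⱽ v ≈ⱽ λ i → (M *ⱽ v) i - (N *ⱽ v) i
    *ⱽ-distribʳ-minus M N v i =
      trans (∑-cong λ j → [y-z]x≈yx-zx (v j) (M i j) (N i j))
            (∑-minus (λ j → M i j * v j) (λ j → N i j * v j))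

    -ᴹ-*ⱽ : (M : Matrix I (El X)) (v : Vect (El X)) → (-ᴹ M) *ⱽ v ≈ⱽ λ i → - (M *ⱽ v) i
    -ᴹ-*ⱽ M v i =
      trans (∑-cong λ j → sym (-‿distribˡ-* (M i j) (v j))) (∑-neg λ j → M i j * v j)

  -- The pivot is studied through its action on vectors; this law turns the products of matrices in
  -- its blocks into successive applications.
  *ᴹ-*ⱽ-assoc : ∀ {m n} {I : Set} {X : Subset m} {Y : Subset n}
    (M : Matrix I (El X)) (N : Matrix (El X) (El Y)) v → (M *ᴹ N) *ⱽ v ≈ⱽ M *ⱽ (N *ⱽ v)
  *ᴹ-*ⱽ-assoc {X = X} {Y} M N v i = begin
    ∑ Y (λ k → ∑ X (λ j → M i j * N j k) * v k)
      ≈⟨ ∑-cong (λ k → *-distribʳ-∑ (v k) λ j → M i j * N j k) ⟩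
    ∑ Y (λ k → ∑ X (λ j → M i j * N j k * v k))
      ≈⟨ ∑-swap (λ k j → M i j * N j k * v k) ⟩
    ∑ X (λ j → ∑ Y (λ k → M i j * N j k * v k))
      ≈⟨ ∑-cong (λ j → ∑-cong λ k → *-assoc (M i j) (N j k) (v k)) ⟩
    ∑ X (λ j → ∑ Y (λ k → M i j * (N j k * v k)))
      ≈⟨ ∑-cong (λ j → *-distribˡ-∑ (M i j) λ k → N j k * v k) ⟨
    ∑ X (λ j → M i j * ∑ Y (λ k → N j k * v k)) ∎

  1ᴹ-*ⱽ : ∀ {n} {X : Subset n} (v : Vect (El X)) → 1ᴹ *ⱽ v ≈ⱽ v
  1ᴹ-*ⱽ {X = X} v i = begin
    sum (extend X f)      ≈⟨ sum-single _ (proj₁ i) (split-elim X _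
                               (λ j j≢i → trans (extend-∈ X f j) (off-diagonal j j≢i))
                               (λ { (_ , u∈∁X) _ → extend-∉ X f (x∈∁p⇒x∉p u∈∁X) })) ⟩
    extend X f (proj₁ i)  ≈⟨ extend-∈ X f i ⟩
    1ᴹ {X = X} i i * v i  ≡⟨ ≡.cong (λ b → (if b then 1# else 0#) * v i)
                                    (dec-true (proj₁ i ≟ proj₁ i) ≡.refl) ⟩
    1# * v i              ≈⟨ *-identityˡ (v i) ⟩
    v i                   ∎
    where
    f : Vect (El X)
    f j = 1ᴹ {X = X} i j * v j

    off-diagonal : ∀ j → proj₁ j ≢ proj₁ i → f j ≈ 0#
    off-diagonal j j≢i rewrite dec-false (proj₁ i ≟ proj₁ j) (j≢i ∘ ≡.sym) = zeroˡ (v j)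

  -- The action of a full matrix.

  _·_ : ∀ {n} → Matrix (Fin n) (Fin n) → Vect (Fin n) → Vect (Fin n)
  (A · x) u = sum λ v → A u v * x v

  ·-cong : ∀ {n} (A : Matrix (Fin n) (Fin n)) {x y} → x ≈ⱽ y → A · x ≈ⱽ A · y
  ·-cong A x≈y u = sum-cong-≋ λ v → *-congˡ (x≈y v)

  ·-combination : ∀ {n k} (A : Matrix (Fin n) (Fin n)) (a : Fin k → Carrier) b →
    A · combination a b ≈ⱽ combination a (λ j → A · b j)
  ·-combination A a b u = begin
    sum (λ v → A u v * sum λ j → a j * b j v)
      ≈⟨ sum-cong-≋ (λ v → *-distribˡ-sum (A u v) λ j → a j * b j v) ⟩
    sum (λ v → sum λ j → A u v * (a j * b j v))
      ≈⟨ ∑-comm (λ v j → A u v * (a j * b j v)) ⟩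
    sum (λ j → sum λ v → A u v * (a j * b j v))
      ≈⟨ sum-cong-≋ (λ j → sum-cong-≋ λ v → commute (A u v) (a j) (b j v)) ⟩
    sum (λ j → sum λ v → a j * (A u v * b j v))
      ≈⟨ sum-cong-≋ (λ j → *-distribˡ-sum (a j) λ v → A u v * b j v) ⟨
    sum (λ j → a j * sum λ v → A u v * b j v) ∎
    where
    commute : ∀ x y z → x * (y * z) ≈ y * (x * z)
    commute x y z = trans (sym (*-assoc x y z)) (trans (*-congʳ (*-comm x y)) (*-assoc y x z))

  -- Columns outside `Z` meet zero coordinates. Hence null vectors of `A [ Z ]` correspond to
  -- vectors supported on `Z` whose image under `A` vanishes on `Z`.
  ·-extend : ∀ {n} (A : Matrix (Fin n) (Fin n)) (Z : Subset n) x (i : El Z) →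
             (A · extend Z x) (proj₁ i) ≈ (A [ Z ] *ⱽ x) i
  ·-extend A Z x i = sum-cong-≋ *-extend
    where
    *-extend : ∀ v → A (proj₁ i) v * extend Z x v ≈
                     extend Z (λ j → A (proj₁ i) (proj₁ j) * x j) v
    *-extend = split-elim Z _
      (λ j → trans (*-congˡ (extend-∈ Z x j)) (sym (extend-∈ Z _ j)))
      (λ { (_ , v∈∁Z) → trans (*-congˡ (extend-∉ Z x (x∈∁p⇒x∉p v∈∁Z)))
                          (trans (zeroʳ _) (sym (extend-∉ Z _ (x∈∁p⇒x∉p v∈∁Z)))) })

  -- Exchanging the coordinates in `X` of two vectors.

  override : ∀ {n} → Subset n → Vect (Fin n) → Vect (Fin n) → Vect (Fin n)
  override X x y v = [ const (x v) , const (y v) ]′ (split X v)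

  module _ {n} (X : Subset n) where

    override-∈ : ∀ x y (i : El X) → override X x y (proj₁ i) ≈ x (proj₁ i)
    override-∈ x y i rewrite split-∈ X i = refl

    override-∉ : ∀ x y (i : El (∁ X)) → override X x y (proj₁ i) ≈ y (proj₁ i)
    override-∉ x y i rewrite split-∉ X i = refl

    override-elim : ∀ x y {v z} → (v ∈ X → x v ≈ z) → (v ∉ X → y v ≈ z) →
                    override X x y v ≈ z
    override-elim x y {v} on off with v ∈? X
    ... | yes v∈X = on v∈X
    ... | no  v∉X = off v∉X

    override-cong : ∀ {x x′ y y′} → x ≈ⱽ x′ → y ≈ⱽ y′ → override X x y ≈ⱽ override X x′ y′
    override-cong x≈x′ y≈y′ v with split X v
    ... | inj₁ _ = x≈x′ v
    ... | inj₂ _ = y≈y′ v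

    -- Swapping coordinates in `X` turns the pair `x`, `y` into `override X y x`, `override X x y`.
    -- Swapping again restores the pair, and this is its first component.
    override-override : ∀ x y → override X (override X x y) (override X y x) ≈ⱽ x
    override-override x y v with split X v
    ... | inj₁ _ = refl
    ... | inj₂ _ = refl

    override-combination : ∀ {k} (a : Fin k → Carrier) b b′ →
      override X (combination a b) (combination a b′) ≈ⱽ
      combination a (λ j → override X (b j) (b′ j))
    override-combination a b b′ v with split X v
    ... | inj₁ _ = refl
    ... | inj₂ _ = refl

  -- Swapping coordinates in `X` sends the graph of `A` into the graph of `B`. Since swapping is an
  -- involution, `Exchanges X B A` is the reverse inclusion.
  Exchanges : ∀ {n} → Subset n → (A B : Matrix (Fin n) (Fin n)) → Set _
  Exchanges X A B = ∀ x → B · override X (A · x) x ≈ⱽ override X x (A · x)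

  -- The action of a block matrix.

  module _ {n} (X : Subset n)
    {P : Matrix (El X)     (El X)} {Q : Matrix (El X)     (El (∁ X))}
    {R : Matrix (El (∁ X)) (El X)} {S : Matrix (El (∁ X)) (El (∁ X))} where

    blocks-·-∈ : ∀ x i → (blocks X P Q R S · x) (proj₁ i) ≈
                         (P *ⱽ (x ∘ proj₁)) i + (Q *ⱽ (x ∘ proj₁)) i
    blocks-·-∈ x i = trans (sum-partition X _)
      (+-cong (∑-cong λ j → *-congʳ (reflexive (eq₁ j)))
              (∑-cong λ j → *-congʳ (reflexive (eq₂ j))))
      where
      eq₁ : ∀ j → blocks X P Q R S (proj₁ i) (proj₁ j) ≡ P i j
      eq₁ j rewrite split-∈ X i | split-∈ X j = ≡.refl
      eq₂ : ∀ j → blocks X P Q R S (proj₁ i) (proj₁ j) ≡ Q i j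
      eq₂ j rewrite split-∈ X i | split-∉ X j = ≡.refl

    blocks-·-∉ : ∀ x i → (blocks X P Q R S · x) (proj₁ i) ≈
                         (R *ⱽ (x ∘ proj₁)) i + (S *ⱽ (x ∘ proj₁)) i
    blocks-·-∉ x i = trans (sum-partition X _)
      (+-cong (∑-cong λ j → *-congʳ (reflexive (eq₁ j)))
              (∑-cong λ j → *-congʳ (reflexive (eq₂ j))))
      where
      eq₁ : ∀ j → blocks X P Q R S (proj₁ i) (proj₁ j) ≡ R i j
      eq₁ j rewrite split-∉ X i | split-∈ X j = ≡.refl
      eq₂ : ∀ j → blocks X P Q R S (proj₁ i) (proj₁ j) ≡ S i j
      eq₂ j rewrite split-∉ X i | split-∉ X j = ≡.refl

  -- The pivot exchanges coordinates.

  module _ {n} (A : Matrix (Fin n) (Fin n)) (X : Subset n) (ns : Nonsingular (A [ X ])) where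

    private
      P   = A [ X ]
      Q   = A [ X ∣ ∁ X ]
      R   = A [ ∁ X ∣ X ]
      S   = A [ ∁ X ∣ ∁ X ]
      P⁻¹ = proj₁ ns
      B   = pivot A X ns

      -- The solution of P z + Q x₂ = x₁, where x = (x₁ , x₂).
      solve : Vect (Fin n) → Vect (El X)
      solve x = P⁻¹ *ⱽ λ i → x (proj₁ i) - (Q *ⱽ (x ∘ proj₁)) i

    -- The left inverse law makes the solution of `P z + Q x₂ = x₁` unique; the right inverse law,
    -- next, makes `solve x` a solution.
    P⁻¹-*ⱽ-P : ∀ v → P⁻¹ *ⱽ (P *ⱽ v) ≈ⱽ v
    P⁻¹-*ⱽ-P v i = trans (sym (*ᴹ-*ⱽ-assoc P⁻¹ P v i))
      (trans (*ⱽ-congʳ v (proj₁ (proj₂ ns)) i) (1ᴹ-*ⱽ v i))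

    P-*ⱽ-P⁻¹ : ∀ v → P *ⱽ (P⁻¹ *ⱽ v) ≈ⱽ v
    P-*ⱽ-P⁻¹ v i = trans (sym (*ᴹ-*ⱽ-assoc P P⁻¹ v i))
      (trans (*ⱽ-congʳ v (proj₂ (proj₂ ns)) i) (1ᴹ-*ⱽ v i))

    -- `P⁻¹` factors out of the upper block row `P⁻¹ x₁ - P⁻¹ Q x₂`.
    pivot-·-∈ : ∀ x i → (B · x) (proj₁ i) ≈ solve x i
    pivot-·-∈ x i = begin
      (B · x) (proj₁ i)
        ≈⟨ blocks-·-∈ X x i ⟩
      (P⁻¹ *ⱽ x₁) i + ((-ᴹ (P⁻¹ *ᴹ Q)) *ⱽ x₂) i
        ≈⟨ +-congˡ (-ᴹ-*ⱽ (P⁻¹ *ᴹ Q) x₂ i) ⟩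
      (P⁻¹ *ⱽ x₁) i - ((P⁻¹ *ᴹ Q) *ⱽ x₂) i
        ≈⟨ +-congˡ (-‿cong (*ᴹ-*ⱽ-assoc P⁻¹ Q x₂ i)) ⟩
      (P⁻¹ *ⱽ x₁) i - (P⁻¹ *ⱽ (Q *ⱽ x₂)) i
        ≈⟨ *ⱽ-distribˡ-minus P⁻¹ x₁ (Q *ⱽ x₂) i ⟨
      solve x i ∎
      where
      -- The two bodies coincide, but their uses fix different index types: `El X` for `x₁` and
      -- `El (∁ X)` for `x₂`.
      x₁ = x ∘ proj₁
      x₂ = x ∘ proj₁

    -- Regrouping the Schur complement row gives `R P⁻¹ (x₁ - Q x₂) + S x₂`, which is the lower
    -- block row of `A` applied to `(solve x , x₂)`.
    pivot-·-∉ : ∀ x i → (B · x) (proj₁ i) ≈ (R *ⱽ solve x) i + (S *ⱽ (x ∘ proj₁)) i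
    pivot-·-∉ x i = begin
      (B · x) (proj₁ i)
        ≈⟨ blocks-·-∉ X x i ⟩
      ((R *ᴹ P⁻¹) *ⱽ x₁) i + ((S -ᴹ R *ᴹ P⁻¹ *ᴹ Q) *ⱽ x₂) i
        ≈⟨ +-congˡ (*ⱽ-distribʳ-minus S (R *ᴹ P⁻¹ *ᴹ Q) x₂ i) ⟩
      ((R *ᴹ P⁻¹) *ⱽ x₁) i + ((S *ⱽ x₂) i - ((R *ᴹ P⁻¹ *ᴹ Q) *ⱽ x₂) i)
        ≈⟨ +-congˡ (+-comm _ _) ⟩
      ((R *ᴹ P⁻¹) *ⱽ x₁) i + (- ((R *ᴹ P⁻¹ *ᴹ Q) *ⱽ x₂) i + (S *ⱽ x₂) i)
        ≈⟨ +-assoc _ _ _ ⟨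
      (((R *ᴹ P⁻¹) *ⱽ x₁) i - ((R *ᴹ P⁻¹ *ᴹ Q) *ⱽ x₂) i) + (S *ⱽ x₂) i
        ≈⟨ +-congʳ (+-congˡ (-‿cong (*ᴹ-*ⱽ-assoc (R *ᴹ P⁻¹) Q x₂ i))) ⟩
      (((R *ᴹ P⁻¹) *ⱽ x₁) i - ((R *ᴹ P⁻¹) *ⱽ (Q *ⱽ x₂)) i) + (S *ⱽ x₂) i
        ≈⟨ +-congʳ (*ⱽ-distribˡ-minus (R *ᴹ P⁻¹) x₁ (Q *ⱽ x₂) i) ⟨
      ((R *ᴹ P⁻¹) *ⱽ (λ j → x₁ j - (Q *ⱽ x₂) j)) i + (S *ⱽ x₂) i
        ≈⟨ +-congʳ (*ᴹ-*ⱽ-assoc R P⁻¹ _ i) ⟩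
      (R *ⱽ solve x) i + (S *ⱽ x₂) i ∎
      where
      x₁ = x ∘ proj₁
      x₂ = x ∘ proj₁

    -- The hypothesis says `x₁ - Q x₂ = P z`, and `P⁻¹` recovers `z`.
    solve-unique : ∀ x z → (∀ i → (P *ⱽ z) i + (Q *ⱽ (x ∘ proj₁)) i ≈ x (proj₁ i)) →
                   solve x ≈ⱽ z
    solve-unique x z Pz+Qx₂≈x₁ i = trans
      (*ⱽ-congˡ P⁻¹ (λ j → trans (+-congʳ (sym (Pz+Qx₂≈x₁ j))) (//-rightDividesʳ _ _)) i)
      (P⁻¹-*ⱽ-P z i)

    -- The upper block row of `A · x` says that the `X` part of `x` solves the system posed by `x′`,
    -- so `solve x′` is that part. The lower row of `B · x′` is then the lower row of `A · x`.
    pivot-exchanges : Exchanges X A B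
    pivot-exchanges x = split-elim X _
      (λ i → begin
        (B · x′) (proj₁ i)                 ≈⟨ pivot-·-∈ x′ i ⟩
        solve x′ i                         ≈⟨ solve-x′ i ⟩
        x (proj₁ i)                        ≈⟨ override-∈ X x (A · x) i ⟨
        override X x (A · x) (proj₁ i)     ∎)
      (λ i → begin
        (B · x′) (proj₁ i)                 ≈⟨ pivot-·-∉ x′ i ⟩
        (R *ⱽ solve x′) i + (S *ⱽ (x′ ∘ proj₁)) i
          ≈⟨ +-cong (*ⱽ-congˡ R solve-x′ i) (*ⱽ-congˡ S (override-∉ X (A · x) x) i) ⟩
        (R *ⱽ (x ∘ proj₁)) i + (S *ⱽ (x ∘ proj₁)) i
          ≈⟨ sum-partition X (λ v → A (proj₁ i) v * x v) ⟨
        (A · x) (proj₁ i)                  ≈⟨ override-∉ X x (A · x) i ⟨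
        override X x (A · x) (proj₁ i)     ∎)
      where
      x′ = override X (A · x) x

      solve-x′ : solve x′ ≈ⱽ x ∘ proj₁
      solve-x′ = solve-unique x′ (x ∘ proj₁) λ i → begin
        (P *ⱽ (x ∘ proj₁)) i + (Q *ⱽ (x′ ∘ proj₁)) i
          ≈⟨ +-congˡ (*ⱽ-congˡ Q (override-∉ X (A · x) x) i) ⟩
        (P *ⱽ (x ∘ proj₁)) i + (Q *ⱽ (x ∘ proj₁)) i
          ≈⟨ sum-partition X (λ v → A (proj₁ i) v * x v) ⟨
        (A · x) (proj₁ i)
          ≈⟨ override-∈ X (A · x) x i ⟨
        x′ (proj₁ i) ∎

    -- Here `x′` is `(solve x , x₂)`. In the upper row `A` returns `x₁`, because `solve x` is a
    -- solution; the lower row is `pivot-·-∉` read backwards.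
    exchanges-pivot : Exchanges X B A
    exchanges-pivot x = split-elim X _
      (λ i → begin
        (A · x′) (proj₁ i)                 ≈⟨ A·x′ (proj₁ i) ⟩
        (P *ⱽ solve x) i + (Q *ⱽ (x ∘ proj₁)) i
          ≈⟨ +-congʳ (P-*ⱽ-P⁻¹ _ i) ⟩
        (x (proj₁ i) - (Q *ⱽ (x ∘ proj₁)) i) + (Q *ⱽ (x ∘ proj₁)) i
          ≈⟨ //-rightDividesˡ _ _ ⟩
        x (proj₁ i)                        ≈⟨ override-∈ X x (B · x) i ⟨
        override X x (B · x) (proj₁ i)     ∎)
      (λ i → begin
        (A · x′) (proj₁ i)                 ≈⟨ A·x′ (proj₁ i) ⟩
        (R *ⱽ solve x) i + (S *ⱽ (x ∘ proj₁)) i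
          ≈⟨ pivot-·-∉ x i ⟨
        (B · x) (proj₁ i)                  ≈⟨ override-∉ X x (B · x) i ⟨
        override X x (B · x) (proj₁ i)     ∎)
      where
      x′ = override X (B · x) x

      A·x′ : ∀ u → (A · x′) u ≈
             ∑ X (λ j → A u (proj₁ j) * solve x j) + ∑ (∁ X) (λ j → A u (proj₁ j) * x (proj₁ j))
      A·x′ u = trans (sum-partition X (λ v → A u v * x′ v))
        (+-cong (∑-cong λ j → *-congˡ (trans (override-∈ X (B · x) x j) (pivot-·-∈ x j)))
                (∑-cong λ j → *-congˡ (override-∉ X (B · x) x j)))

  -- The maps between the null spaces.

  exchange : ∀ {n} (A : Matrix (Fin n) (Fin n)) (X Z Y : Subset n) → Vect (El Z) → Vect (El Y)
  exchange A X Z Y x = override X (A · extend Z x) (extend Z x) ∘ proj₁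

  module _ {n} (A : Matrix (Fin n) (Fin n)) (X Z Y : Subset n) where

    exchange-cong : ∀ {x x′} → x ≈ⱽ x′ → exchange A X Z Y x ≈ⱽ exchange A X Z Y x′
    exchange-cong x≈x′ (v , _) =
      override-cong X (·-cong A (extend-cong Z x≈x′)) (extend-cong Z x≈x′) v

    -- Extension by zero, the action of `A`, `override` and restriction each commute with
    -- combinations, on all vectors and not only on null vectors.
    exchange-combination : ∀ {k} (a : Fin k → Carrier) b →
      exchange A X Z Y (combination a b) ≈ⱽ combination a (exchange A X Z Y ∘ b)
    exchange-combination a b (v , _) = trans
      (override-cong X
        (λ u → trans (·-cong A (extend-combination Z a b) u) (·-combination A a (extend Z ∘ b) u))
        (extend-combination Z a b) v)
      (override-combination X a (λ j → A · extend Z (b j)) (extend Z ∘ b) v)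

  module _ {n} (A B : Matrix (Fin n) (Fin n)) (X Z Y : Subset n)
           (Z≡X⊕Y : Z ≡ X ⊕ Y) (A↔B : Exchanges X A B) where

    private
      φ = exchange A X Z Y
      ψ = exchange B X Y Z

      [_]∈Z : ∀ {v} → v ∈ X ⊕ Y → v ∈ Z
      [_]∈Z {v} = ≡.subst (v ∈_) (≡.sym Z≡X⊕Y)

      [_]∉Z : ∀ {v} → v ∉ X ⊕ Y → v ∉ Z
      [_]∉Z {v} = ≡.subst (v ∉_) (≡.sym Z≡X⊕Y)

    module _ (x : Vect (El Z)) (x∈N : NullSpace (A [ Z ]) x) where

      private
        u = extend Z x
        w = A · u

      image-vanishes : ∀ {v} → v ∈ Z → w v ≈ 0#
      image-vanishes v∈Z = trans (·-extend A Z x (_ , v∈Z)) (x∈N (_ , v∈Z))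

      -- Outside `Y`, lying in `X` and lying in `Z` are the same: on `X` the image `w` vanishes, off
      -- `X` the extension `u` does.
      exchange-supported : ∀ {v} → v ∉ Y → override X w u v ≈ 0#
      exchange-supported v∉Y = override-elim X w u
        (λ v∈X → image-vanishes [ x∈p∧x∉q⇒x∈p⊕q v∈X v∉Y ]∈Z)
        (λ v∉X → extend-∉ Z x [ x∉p∧x∉q⇒x∉p⊕q v∉X v∉Y ]∉Z)

      -- Inside `Y`, lying in `X` and lying in `Z` are opposite, so `u` vanishes on `X` and `w` off
      -- it.
      exchanged-image-vanishes : ∀ {v} → v ∈ Y → override X u w v ≈ 0#
      exchanged-image-vanishes v∈Y = override-elim X u w
        (λ v∈X → extend-∉ Z x [ x∈p∧x∈q⇒x∉p⊕q v∈X v∈Y ]∉Z)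
        (λ v∉X → image-vanishes [ x∉p∧x∈q⇒x∈p⊕q v∉X v∈Y ]∈Z)

      -- Restricting to `Y` loses nothing, since the exchanged vector is supported there.
      extend-exchange : extend Y (φ x) ≈ⱽ override X w u
      extend-exchange = extend-restrict Y (override X w u) exchange-supported

      ·-exchange : B · extend Y (φ x) ≈ⱽ override X u w
      ·-exchange v = trans (·-cong B extend-exchange v) (A↔B u v)

      exchange∈NullSpace : NullSpace (B [ Y ]) (φ x)
      exchange∈NullSpace i@(_ , v∈Y) = trans (sym (·-extend B Y (φ x) i))
        (trans (·-exchange _) (exchanged-image-vanishes v∈Y))

      -- The extension of `φ x` and its image under `B` form the swapped pair of `u` and `w`, which
      -- `ψ` swaps back.
      exchange-inverse : ψ (φ x) ≈ⱽ x
      exchange-inverse i = trans (override-cong X ·-exchange extend-exchange (proj₁ i))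
        (trans (override-override X u w (proj₁ i)) (extend-∈ Z x i))

  -- Transport of dimension and conclusion.

  hasDimension-iso : ∀ {I J : Set} {ℓ ℓ′} {U : Vect I → Set ℓ} {U′ : Vect J → Set ℓ′} {k}
    (φ : Vect I → Vect J) (ψ : Vect J → Vect I) →
    (∀ {x y} → x ≈ⱽ y → φ x ≈ⱽ φ y) →
    (∀ {x y} → x ≈ⱽ y → ψ x ≈ⱽ ψ y) →
    (∀ {k} (a : Fin k → Carrier) b → φ (combination a b) ≈ⱽ combination a (φ ∘ b)) →
    (∀ {k} (a : Fin k → Carrier) b → ψ (combination a b) ≈ⱽ combination a (ψ ∘ b)) →
    (∀ x → U x → U′ (φ x)) → (∀ y → U′ y → U (ψ y)) →
    (∀ x → U x → ψ (φ x) ≈ⱽ x) → (∀ y → U′ y → φ (ψ y) ≈ⱽ y) →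
    HasDimension U k → HasDimension U′ k
  hasDimension-iso φ ψ φ-cong ψ-cong φ-combination ψ-combination φ∈U′ ψ∈U ψφ≈id φψ≈id dim = record
    { basis       = φ ∘ basis
    ; basis∈      = λ j → φ∈U′ (basis j) (basis∈ j)
    -- A relation between the images is pulled back along `ψ`. The inverse law is applied to the
    -- basis vectors one by one, as these are known to lie in `U`.
    ; independent = λ a aφb≈0 → independent a λ i → begin
        combination a basis i            ≈⟨ combination-cong a (λ j → ψφ≈id (basis j) (basis∈ j)) i ⟨
        combination a (ψ ∘ φ ∘ basis) i  ≈⟨ ψ-combination a (φ ∘ basis) i ⟨
        ψ (combination a (φ ∘ basis)) i  ≈⟨ ψ-cong aφb≈0 i ⟩
        -- 0ⱽ is the empty combination.
        ψ 0ⱽ i                           ≈⟨ ψ-combination {0} (λ ()) (λ ()) i ⟩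
        0#                               ∎
    -- The coefficients for `y` are those of `ψ y` in the original basis.
    ; spanning    = λ y y∈U′ → let a , ψy≈ab = spanning (ψ y) (ψ∈U y y∈U′) in
        a , λ j → begin
          y j                          ≈⟨ φψ≈id y y∈U′ j ⟨
          φ (ψ y) j                    ≈⟨ φ-cong ψy≈ab j ⟩
          φ (combination a basis) j    ≈⟨ φ-combination a basis j ⟩
          combination a (φ ∘ basis) j  ∎
    }
    where open HasDimension dim

  -- With both equations between `Y` and `Z` as hypotheses, the assumptions are symmetric under
  -- interchanging `A` with `B` and `Z` with `Y`, so both directions of the theorem are instances.
  exchange-nullity : ∀ {n} (A B : Matrix (Fin n) (Fin n)) (X Z Y : Subset n) →
    Z ≡ X ⊕ Y → Y ≡ X ⊕ Z → Exchanges X A B → Exchanges X B A →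
    ∀ {k} → HasNullity (A [ Z ]) k → HasNullity (B [ Y ]) k
  exchange-nullity A B X Z Y Z≡X⊕Y Y≡X⊕Z A↔B B↔A = hasDimension-iso
    (exchange A X Z Y) (exchange B X Y Z)
    (exchange-cong A X Z Y) (exchange-cong B X Y Z)
    (exchange-combination A X Z Y) (exchange-combination B X Y Z)
    (exchange∈NullSpace A B X Z Y Z≡X⊕Y A↔B) (exchange∈NullSpace B A X Y Z Y≡X⊕Z B↔A)
    (exchange-inverse A B X Z Y Z≡X⊕Y A↔B) (exchange-inverse B A X Y Z Y≡X⊕Z B↔A)

theorem5 : ∀ {c ℓ₁ ℓ₂} (F : HeytingField c ℓ₁ ℓ₂) → let open Over F in
    ∀ (n : ℕ) (A : Matrix (Fin n) (Fin n)) (X : Subset n) (ns : Nonsingular (A [ X ])) →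
    ∀ (Y : Subset n) (k : ℕ) →
    HasNullity (pivot A X ns [ Y ]) k ⇔ HasNullity (A [ X ⊕ Y ]) k
theorem5 F n A X ns Y k = mk⇔
  -- From the pivot to `A`, the set `Y` plays the part of `Z`, which is where the involution law
  -- enters.
  (exchange-nullity F B A X Y (X ⊕ Y) Y≡X⊕[X⊕Y] ≡.refl B↔A A↔B)
  (exchange-nullity F A B X (X ⊕ Y) Y ≡.refl Y≡X⊕[X⊕Y] A↔B B↔A)
  where
  B = Over.pivot F A X ns
  A↔B = pivot-exchanges F A X ns
  B↔A = exchanges-pivot F A X ns
  Y≡X⊕[X⊕Y] = ≡.sym (p⊕[p⊕q]≡q X Y)
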